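{- Let $n \geq 1$ and $k \geq 0$ be integers. If $\mathcal{F}$ is a locally $k$-wide family of subsets of an $n$-element set, then $|\mathcal{F}| \leq 2 + n + kn\ln(n)$.
   Context: A family $\mathcal{F}$ of subsets of a finite set $X$ is locally $k$-wide iff for every $x \in X$ every antichain (with respect to inclusion) of $\{U \in \mathcal{F} \mid x \in U\}$ has at most $k$ members. $\ln$ is the natural logarithm. -}

module Defs where

open import Data.Nat.Base as ℕ using (ℕ; zero; suc)
import Data.Nat.Properties as ℕ
open import Data.Integer.Base using (+[1+_]; -[1+_])
import Data.Integer.Base as ℤ
import Data.Integer.Properties as ℤ
open import Data.Rational.Base as ℚ
  using (ℚ; 0ℚ; 1ℚ; mkℚ; _+_; _-_; _*_; -_; 1/_; ∣_∣; _≤_; Positive)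
open import Data.Rational.Properties
import Data.Rational.Unnormalised.Base as ℚᵘ
import Data.Rational.Unnormalised.Properties as ℚᵘ
open import Data.Rational.Solver using (module +-*-Solver)
open import Data.Fin.Base using (Fin)
open import Data.Fin.Subset using (Subset; _⊆_) renaming (_∈_ to _∈ₛ_)
open import Data.List.Base using (List; length)
open import Data.List.Membership.Propositional using (_∈_)
open import Data.List.Relation.Unary.Unique.Propositional using (Unique)
open import Data.Product.Base using (∃-syntax; _×_; _,_)
open import Data.Sum.Base using (inj₁; inj₂)
open import Relation.Binary.PropositionalEquality.Core
  using (_≡_; refl; sym; trans; cong; cong₂; subst; subst₂)
open import Relation.Binary.PropositionalEquality.Properties using (module ≡-Reasoning)
open +-*-Solver using (solve; _:=_; _:+_; _:*_; _:-_; :-_; con)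

infix 10 _⁻¹
infixl 7 _*ᴿ_
infixl 6 _+ᴿ_
infix 4 _≤ᴿ_

record Family (n : ℕ) : Set where
  constructor family
  field
    members : List (Subset n)
    unique  : Unique members

open Family public

infix 4 _∈ᶠ_
_∈ᶠ_ : ∀ {n} → Subset n → Family n → Set
U ∈ᶠ F = U ∈ members F

size : ∀ {n} → Family n → ℕ
size F = length (members F)

Antichain : ∀ {n} → Family n → Set
Antichain A = ∀ U V → U ∈ᶠ A → V ∈ᶠ A → U ⊆ V → U ≡ V

LocallyWide : ∀ {n} → ℕ → Family n → Set
LocallyWide {n} k F =
  ∀ (x : Fin n) (A : Family n) → (∀ U → U ∈ᶠ A → U ∈ᶠ F × x ∈ₛ U) →
  Antichain A → size A ℕ.≤ k

fromℕ : ℕ → ℚ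
fromℕ n = ℤ.+ n ℚ./ 1

-- Total reciprocal, with 0 ⁻¹ = 0.
_⁻¹ : ℚ → ℚ
mkℚ (ℤ.+ 0)      _ _ ⁻¹ = 0ℚ
p@(mkℚ +[1+ _ ] _ _) ⁻¹ = 1/ p
p@(mkℚ -[1+ _ ] _ _) ⁻¹ = 1/ p

∑ : ℕ → (ℕ → ℚ) → ℚ
∑ zero    f = 0ℚ
∑ (suc n) f = ∑ n f + f n

fromℕ-pos : ∀ n → .{{ℕ.NonZero n}} → Positive (fromℕ n)
fromℕ-pos n = normalize-pos n 1

private
  fromℕᵘ : ∀ n → ℚ.toℚᵘ (fromℕ n) ℚᵘ.≃ ℚᵘ.mkℚᵘ (ℤ.+ n) 0
  fromℕᵘ n = toℚᵘ-fromℚᵘ (ℚᵘ.mkℚᵘ (ℤ.+ n) 0)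

fromℕ-+ : ∀ m n → fromℕ (m ℕ.+ n) ≡ fromℕ m + fromℕ n
fromℕ-+ m n = toℚᵘ-injective (begin
  ℚ.toℚᵘ (fromℕ (m ℕ.+ n))                  ≈⟨ fromℕᵘ (m ℕ.+ n) ⟩
  ℚᵘ.mkℚᵘ (ℤ.+ (m ℕ.+ n)) 0                   ≈⟨ ℚᵘ.*≡* (cong (ℤ._* (ℤ.+ 1)) (sym (cong₂ ℤ._+_ (ℤ.*-identityʳ (ℤ.+ m)) (ℤ.*-identityʳ (ℤ.+ n))))) ⟩
  ℚᵘ.mkℚᵘ (ℤ.+ m) 0 ℚᵘ.+ ℚᵘ.mkℚᵘ (ℤ.+ n) 0      ≈⟨ ℚᵘ.+-cong (fromℕᵘ m) (fromℕᵘ n) ⟨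
  ℚ.toℚᵘ (fromℕ m) ℚᵘ.+ ℚ.toℚᵘ (fromℕ n)    ≈⟨ toℚᵘ-homo-+ (fromℕ m) (fromℕ n) ⟨
  ℚ.toℚᵘ (fromℕ m + fromℕ n)                ∎)
  where open ℚᵘ.≃-Reasoning

fromℕ-* : ∀ m n → fromℕ (m ℕ.* n) ≡ fromℕ m * fromℕ n
fromℕ-* zero    n = sym (*-zeroˡ (fromℕ n))
fromℕ-* (suc m) n = trans (fromℕ-+ n (m ℕ.* n)) (trans (cong (fromℕ n +_) (fromℕ-* m n))
  (trans (solve 2 (λ a b → b :+ a :* b := (con 1ℚ :+ a) :* b) refl (fromℕ m) (fromℕ n))
         (cong (_* fromℕ n) (sym (fromℕ-+ 1 m)))))

fromℕ-nonNeg : ∀ n → 0ℚ ≤ fromℕ n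
fromℕ-nonNeg n = nonNegative⁻¹ (fromℕ n) {{normalize-nonNeg n 1}}

fromℕ-mono : ∀ {m n} → m ℕ.≤ n → fromℕ m ≤ fromℕ n
fromℕ-mono {m} {n} m≤n = toℚᵘ-cancel-≤
  (ℚᵘ.≤-respˡ-≃ (ℚᵘ.≃-sym (fromℕᵘ m)) (ℚᵘ.≤-respʳ-≃ (ℚᵘ.≃-sym (fromℕᵘ n))
    (ℚᵘ.*≤* (ℤ.*-monoʳ-≤-nonNeg (ℤ.+ 1) (ℤ.+≤+ m≤n)))))

archimedean : ∀ p → ∃[ n ] p ≤ fromℕ n
archimedean p@(mkℚ z d _) = ℤ.∣ z ∣ , toℚᵘ-cancel-≤
  (ℚᵘ.≤-respʳ-≃ (ℚᵘ.≃-sym (fromℕᵘ ℤ.∣ z ∣)) (ℚᵘ.*≤* (lemma z)))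
  where
  lemma : ∀ z → z ℤ.* (ℤ.+ 1) ℤ.≤ (ℤ.+ ℤ.∣ z ∣) ℤ.* (ℤ.+ suc d)
  lemma (ℤ.+ n)    = subst₂ ℤ._≤_ (ℤ.pos-* n 1) (ℤ.pos-* n (suc d))
                     (ℤ.+≤+ (ℕ.*-monoʳ-≤ n (ℕ.s≤s ℕ.z≤n)))
  lemma -[1+ n ] = ℤ.-≤+

⁻¹-pos : ∀ p → .{{Positive p}} → Positive (p ⁻¹)
⁻¹-pos p@(mkℚ +[1+ _ ] _ _) = 1/pos⇒pos p

⁻¹-inverseʳ : ∀ p → .{{Positive p}} → p * p ⁻¹ ≡ 1ℚ
⁻¹-inverseʳ p@(mkℚ +[1+ _ ] _ _) = *-inverseʳ p

0≤* : ∀ {p q} → 0ℚ ≤ p → 0ℚ ≤ q → 0ℚ ≤ p * q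
0≤* {p} {q} 0≤p 0≤q = nonNegative⁻¹ (p * q)
  {{nonNeg*nonNeg⇒nonNeg p {{ℚ.nonNegative 0≤p}} q {{ℚ.nonNegative 0≤q}}}}

square-nonNeg : ∀ p → 0ℚ ≤ p * p
square-nonNeg p with ≤-total 0ℚ p
... | inj₁ 0≤p = 0≤* 0≤p 0≤p
... | inj₂ p≤0 = subst (0ℚ ≤_) (solve 1 (λ p → (:- p) :* (:- p) := p :* p) refl p)
                   (0≤* (neg-antimono-≤ p≤0) (neg-antimono-≤ p≤0))

≤+⇒-≤ : ∀ p q r → p ≤ q + r → p - q ≤ r
≤+⇒-≤ p q r h = subst₂ _≤_ refl
  (solve 2 (λ q r → (q :+ r) :- q := r) refl q r) (+-monoˡ-≤ (- q) h)

p≤p+q : ∀ {p q} → 0ℚ ≤ q → p ≤ p + q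
p≤p+q {p} {q} 0≤q = subst (_≤ p + q) (+-identityʳ p) (+-monoʳ-≤ p 0≤q)

∣p∣≤ : ∀ {p q} → p ≤ q → - p ≤ q → ∣ p ∣ ≤ q
∣p∣≤ {p} {q} p≤q -p≤q with ∣p∣≡p∨∣p∣≡-p p
... | inj₁ eq = subst (_≤ q) (sym eq) p≤q
... | inj₂ eq = subst (_≤ q) (sym eq) -p≤q

*-mono-≤-nonNeg : ∀ {p q r s} → 0ℚ ≤ r → 0ℚ ≤ q → p ≤ q → r ≤ s → p * r ≤ q * s
*-mono-≤-nonNeg {p} {q} {r} {s} 0≤r 0≤q p≤q r≤s = ≤-trans
  (*-monoʳ-≤-nonNeg r {{ℚ.nonNegative 0≤r}} p≤q)
  (*-monoˡ-≤-nonNeg q {{ℚ.nonNegative 0≤q}} r≤s)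

Cauchy : (ℕ → ℚ) → Set
Cauchy x = ∀ ε → Positive ε →
  ∃[ N ] ∀ m n → N ℕ.≤ m → N ℕ.≤ n → ∣ x m - x n ∣ ≤ ε

record ℝ : Set where
  constructor mkℝ
  field
    seq    : ℕ → ℚ
    cauchy : Cauchy seq

open ℝ public

_≤ᴿ_ : ℝ → ℝ → Set
x ≤ᴿ y = ∀ ε → Positive ε → ∃[ N ] ∀ m → N ℕ.≤ m → seq x m ≤ seq y m + ε

fromℚ : ℚ → ℝ
fromℚ q = mkℝ (λ _ → q) λ ε ε>0 → 0 , λ _ _ _ _ →
  subst (_≤ ε) (cong ∣_∣ (sym (+-inverseʳ q))) (<⇒≤ (positive⁻¹ ε {{ε>0}}))

fromℕᴿ : ℕ → ℝ
fromℕᴿ n = fromℚ (fromℕ n)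

_+ᴿ_ : ℝ → ℝ → ℝ
x +ᴿ y = mkℝ (λ m → seq x m + seq y m) λ ε ε>0 →
  let δ  = ℚ.½ * ε
      δ>0 = pos*pos⇒pos ℚ.½ {{_}} ε {{ε>0}}
      N₁ , p = cauchy x δ δ>0
      N₂ , q = cauchy y δ δ>0
  in N₁ ℕ.⊔ N₂ , λ m n N≤m N≤n → begin
    ∣ seq x m + seq y m - (seq x n + seq y n) ∣
      ≡⟨ cong ∣_∣ (solve 4 (λ a b c d → (a :+ b) :- (c :+ d) := (a :- c) :+ (b :- d)) refl
           (seq x m) (seq y m) (seq x n) (seq y n)) ⟩
    ∣ (seq x m - seq x n) + (seq y m - seq y n) ∣
      ≤⟨ ∣p+q∣≤∣p∣+∣q∣ (seq x m - seq x n) (seq y m - seq y n) ⟩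
    ∣ seq x m - seq x n ∣ + ∣ seq y m - seq y n ∣
      ≤⟨ +-mono-≤ (p m n (ℕ.m⊔n≤o⇒m≤o N₁ N₂ N≤m) (ℕ.m⊔n≤o⇒m≤o N₁ N₂ N≤n))
                  (q m n (ℕ.m⊔n≤o⇒n≤o N₁ N₂ N≤m) (ℕ.m⊔n≤o⇒n≤o N₁ N₂ N≤n)) ⟩
    δ + δ ≡⟨ solve 1 (λ e → con ℚ.½ :* e :+ con ℚ.½ :* e := e) refl ε ⟩
    ε ∎
  where open ≤-Reasoning

private
  eventually-bounded : ∀ x → ∃[ B ] Positive B × ∃[ N ] ∀ m → N ℕ.≤ m → ∣ seq x m ∣ ≤ B
  eventually-bounded x =
    let N , p = cauchy x 1ℚ _
        B = 1ℚ + ∣ seq x N ∣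
    in B , pos+nonNeg⇒pos 1ℚ {{_}} ∣ seq x N ∣ {{∣-∣-nonNeg (seq x N)}} , N , λ m N≤m → begin
      ∣ seq x m ∣
        ≡⟨ cong ∣_∣ (solve 2 (λ a b → a := (a :- b) :+ b) refl (seq x m) (seq x N)) ⟩
      ∣ (seq x m - seq x N) + seq x N ∣
        ≤⟨ ∣p+q∣≤∣p∣+∣q∣ (seq x m - seq x N) (seq x N) ⟩
      ∣ seq x m - seq x N ∣ + ∣ seq x N ∣
        ≤⟨ +-monoˡ-≤ ∣ seq x N ∣ (p m N N≤m ℕ.≤-refl) ⟩
      B ∎
    where open ≤-Reasoning

_*ᴿ_ : ℝ → ℝ → ℝ
x *ᴿ y = mkℝ (λ m → seq x m * seq y m) λ ε ε>0 →
  let B₁ , B₁>0 , K₁ , b₁ = eventually-bounded x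
      B₂ , B₂>0 , K₂ , b₂ = eventually-bounded y
      B    = B₁ + B₂
      B>0  = pos+pos⇒pos B₁ {{B₁>0}} B₂ {{B₂>0}}
      δ    = B ⁻¹ * ε
      δ>0  = pos*pos⇒pos (B ⁻¹) {{⁻¹-pos B {{B>0}}}} ε {{ε>0}}
      N₁ , p = cauchy x δ δ>0
      N₂ , q = cauchy y δ δ>0
      K = K₁ ℕ.⊔ K₂
      N = N₁ ℕ.⊔ N₂
      K₁≤ = λ {m} (h : K ℕ.⊔ N ℕ.≤ m) → ℕ.m⊔n≤o⇒m≤o K₁ K₂ (ℕ.m⊔n≤o⇒m≤o K N h)
      K₂≤ = λ {m} (h : K ℕ.⊔ N ℕ.≤ m) → ℕ.m⊔n≤o⇒n≤o K₁ K₂ (ℕ.m⊔n≤o⇒m≤o K N h)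
      N₁≤ = λ {m} (h : K ℕ.⊔ N ℕ.≤ m) → ℕ.m⊔n≤o⇒m≤o N₁ N₂ (ℕ.m⊔n≤o⇒n≤o K N h)
      N₂≤ = λ {m} (h : K ℕ.⊔ N ℕ.≤ m) → ℕ.m⊔n≤o⇒n≤o N₁ N₂ (ℕ.m⊔n≤o⇒n≤o K N h)
  in K ℕ.⊔ N , λ m n m≥ n≥ → begin
    ∣ seq x m * seq y m - seq x n * seq y n ∣
      ≡⟨ cong ∣_∣ (solve 4 (λ a b c d →
           a :* b :- c :* d := a :* (b :- d) :+ d :* (a :- c)) refl
           (seq x m) (seq y m) (seq x n) (seq y n)) ⟩
    ∣ seq x m * (seq y m - seq y n) + seq y n * (seq x m - seq x n) ∣
      ≤⟨ ∣p+q∣≤∣p∣+∣q∣ (seq x m * (seq y m - seq y n)) (seq y n * (seq x m - seq x n)) ⟩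
    ∣ seq x m * (seq y m - seq y n) ∣ + ∣ seq y n * (seq x m - seq x n) ∣
      ≡⟨ cong₂ _+_ (∣p*q∣≡∣p∣*∣q∣ (seq x m) (seq y m - seq y n))
                   (∣p*q∣≡∣p∣*∣q∣ (seq y n) (seq x m - seq x n)) ⟩
    ∣ seq x m ∣ * ∣ seq y m - seq y n ∣ + ∣ seq y n ∣ * ∣ seq x m - seq x n ∣
      ≤⟨ +-mono-≤
           (*-mono-≤-nonNeg (0≤∣p∣ (seq y m - seq y n)) (<⇒≤ (positive⁻¹ B₁ {{B₁>0}}))
             (b₁ m (K₁≤ m≥)) (q m n (N₂≤ m≥) (N₂≤ n≥)))
           (*-mono-≤-nonNeg (0≤∣p∣ (seq x m - seq x n)) (<⇒≤ (positive⁻¹ B₂ {{B₂>0}}))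
             (b₂ n (K₂≤ n≥)) (p m n (N₁≤ m≥) (N₁≤ n≥))) ⟩
    B₁ * δ + B₂ * δ
      ≡⟨ solve 4 (λ a b c e → a :* (c :* e) :+ b :* (c :* e) := ((a :+ b) :* c) :* e) refl
           B₁ B₂ (B ⁻¹) ε ⟩
    (B * B ⁻¹) * ε
      ≡⟨ trans (cong (_* ε) (⁻¹-inverseʳ B {{B>0}})) (*-identityˡ ε) ⟩
    ε ∎
  where open ≤-Reasoning

-- Natural logarithm: ln x = ∫₁ˣ dt / t, the limit of the Riemann sums
-- over N equal steps with right endpoints as tags (for x < 1 the step is
-- negative).
step : ℚ → ℕ → ℚ
step x N = (x - 1ℚ) * fromℕ N ⁻¹

node : ℚ → ℕ → ℕ → ℚ
node x N j = 1ℚ + fromℕ j * step x N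

riemann : ℚ → ℕ → ℚ
riemann x N = ∑ N λ j → step x N * node x N (suc j) ⁻¹

-- The Riemann sums converge because refining a partition increases the
-- sum, by at most (x - 1)(1 - 1/x)/N.

∑-mono : ∀ n {f g} → (∀ j → j ℕ.< n → f j ≤ g j) → ∑ n f ≤ ∑ n g
∑-mono zero    h = ≤-refl
∑-mono (suc n) h = +-mono-≤ (∑-mono n λ j j<n → h j (ℕ.m<n⇒m<1+n j<n)) (h n ℕ.≤-refl)

∑-cong : ∀ n {f g} → (∀ j → f j ≡ g j) → ∑ n f ≡ ∑ n g
∑-cong zero    h = refl
∑-cong (suc n) h = cong₂ _+_ (∑-cong n h) (h n)

∑-const : ∀ n c → ∑ n (λ _ → c) ≡ fromℕ n * c
∑-const zero    c = sym (*-zeroˡ c)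
∑-const (suc n) c = trans (cong (_+ c) (∑-const n c))
  (trans (solve 2 (λ a c → a :* c :+ c := (con 1ℚ :+ a) :* c) refl (fromℕ n) c)
         (cong (_* c) (sym (fromℕ-+ 1 n))))

∑-split : ∀ m n f → ∑ (m ℕ.+ n) f ≡ ∑ m f + ∑ n (λ i → f (m ℕ.+ i))
∑-split m zero    f = trans (cong (λ k → ∑ k f) (ℕ.+-identityʳ m)) (sym (+-identityʳ _))
∑-split m (suc n) f = trans (cong (λ k → ∑ k f) (ℕ.+-suc m n))
  (trans (cong (_+ f (m ℕ.+ n)) (∑-split m n f)) (+-assoc (∑ m f) _ _))

∑-blocks : ∀ N M f → ∑ (N ℕ.* M) f ≡ ∑ N λ j → ∑ M λ i → f (j ℕ.* M ℕ.+ i)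
∑-blocks zero    M f = refl
∑-blocks (suc N) M f = trans (cong (λ k → ∑ k f) (ℕ.+-comm M (N ℕ.* M)))
  (trans (∑-split (N ℕ.* M) M f) (cong (_+ ∑ M (λ i → f (N ℕ.* M ℕ.+ i))) (∑-blocks N M f)))

private
  ⁻¹-step-mono : ∀ p q c d → Positive p → Positive q → 0ℚ ≤ d → q ≡ p + d * c →
                 c * q ⁻¹ ≤ c * p ⁻¹
  ⁻¹-step-mono p q c d p>0 q>0 0≤d q≡ = *-cancelʳ-≤-pos (p * q)
    {{pos*pos⇒pos p {{p>0}} q {{q>0}}}} (begin
      c * q ⁻¹ * (p * q)    ≡⟨ solve 4 (λ c p q r → c :* r :* (p :* q) := c :* p :* (q :* r)) refl c p q (q ⁻¹) ⟩
      c * p * (q * q ⁻¹)    ≡⟨ trans (cong (c * p *_) (⁻¹-inverseʳ q {{q>0}})) (*-identityʳ _) ⟩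
      c * p                 ≤⟨ p≤p+q (0≤* 0≤d (square-nonNeg c)) ⟩
      c * p + d * (c * c)   ≡⟨ solve 3 (λ c p d → c :* p :+ d :* (c :* c) := c :* (p :+ d :* c)) refl c p d ⟩
      c * (p + d * c)       ≡⟨ cong (c *_) q≡ ⟨
      c * q                 ≡⟨ trans (cong (c * q *_) (⁻¹-inverseʳ p {{p>0}})) (*-identityʳ _) ⟨
      c * q * (p * p ⁻¹)    ≡⟨ solve 4 (λ c p q r → c :* q :* (p :* r) := c :* r :* (p :* q)) refl c p q (p ⁻¹) ⟩
      c * p ⁻¹ * (p * q)    ∎)
    where open ≤-Reasoning

  fromℕ-∸ : ∀ {m n} → m ℕ.≤ n → fromℕ n ≡ fromℕ m + fromℕ (n ℕ.∸ m)
  fromℕ-∸ {m} {n} m≤n = trans (cong fromℕ (sym (ℕ.m+[n∸m]≡n m≤n))) (fromℕ-+ m (n ℕ.∸ m))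

  interpolate-pos : ∀ u c M i → Positive u → Positive (u + fromℕ M * c) → i ℕ.≤ M →
                    Positive (u + fromℕ i * c)
  interpolate-pos u c M i u>0 v>0 i≤M with ≤-total 0ℚ c
  ... | inj₁ 0≤c = ℚ.positive (<-≤-trans (positive⁻¹ u {{u>0}})
                     (p≤p+q (0≤* (fromℕ-nonNeg i) 0≤c)))
  ... | inj₂ c≤0 = ℚ.positive (<-≤-trans (positive⁻¹ _ {{v>0}}) (+-monoʳ-≤ u
                     (*-monoʳ-≤-nonPos c {{ℚ.nonPositive c≤0}} (fromℕ-mono i≤M))))

  module Block (u c : ℚ) (M : ℕ) (u>0 : Positive u) (v>0 : Positive (u + fromℕ M * c)) where
    v : ℚ
    v = u + fromℕ M * c

    block : ℚ
    block = ∑ M λ i → c * (u + fromℕ (suc i) * c) ⁻¹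

    lower : fromℕ M * c * v ⁻¹ ≤ block
    lower = subst (_≤ block)
      (trans (∑-const M (c * v ⁻¹)) (sym (*-assoc (fromℕ M) c (v ⁻¹))))
      (∑-mono M λ i i<M →
        ⁻¹-step-mono (u + fromℕ (suc i) * c) v c (fromℕ (M ℕ.∸ suc i))
          (interpolate-pos u c M (suc i) u>0 v>0 i<M) v>0
          (fromℕ-nonNeg (M ℕ.∸ suc i))
          (trans (cong (λ t → u + t * c) (fromℕ-∸ {suc i} {M} i<M))
            (solve 4 (λ u a b c → u :+ (a :+ b) :* c := (u :+ a :* c) :+ b :* c) refl
              u (fromℕ (suc i)) (fromℕ (M ℕ.∸ suc i)) c)))

    upper : block ≤ fromℕ M * c * u ⁻¹
    upper = subst (block ≤_)
      (trans (∑-const M (c * u ⁻¹)) (sym (*-assoc (fromℕ M) c (u ⁻¹))))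
      (∑-mono M λ i i<M →
        ⁻¹-step-mono u (u + fromℕ (suc i) * c) c (fromℕ (suc i)) u>0 (interpolate-pos u c M (suc i) u>0 v>0 i<M)
          (fromℕ-nonNeg (suc i)) refl)

module _ (x : ℚ) .{{x>0 : Positive x}} where

  spread : ℚ
  spread = (x - 1ℚ) * (1ℚ - x ⁻¹)

  fromℕ*step : ∀ N .{{_ : ℕ.NonZero N}} → fromℕ N * step x N ≡ x - 1ℚ
  fromℕ*step N = trans
    (solve 3 (λ a b c → a :* (b :* c) := b :* (a :* c)) refl (fromℕ N) (x - 1ℚ) (fromℕ N ⁻¹))
    (trans (cong ((x - 1ℚ) *_) (⁻¹-inverseʳ (fromℕ N) {{fromℕ-pos N}})) (*-identityʳ _))

  node-last : ∀ N .{{_ : ℕ.NonZero N}} → node x N N ≡ x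
  node-last N = trans (cong (1ℚ +_) (fromℕ*step N))
    (solve 1 (λ x → con 1ℚ :+ (x :- con 1ℚ) := x) refl x)

  node-pos : ∀ N .{{_ : ℕ.NonZero N}} j → j ℕ.≤ N → Positive (node x N j)
  node-pos N j j≤N = interpolate-pos 1ℚ (step x N) N j _ (subst Positive (sym (node-last N)) x>0′) j≤N
    where
    x>0′ : Positive x
    x>0′ = ℚ.positive (positive⁻¹ x)

  step-refine : ∀ N M .{{_ : ℕ.NonZero N}} .{{_ : ℕ.NonZero M}} →
                fromℕ M * step x (N ℕ.* M) ≡ step x N
  step-refine N M = begin
    s                                   ≡⟨ trans (sym (*-identityʳ s)) (cong (s *_) (sym (⁻¹-inverseʳ (fromℕ N) {{fromℕ-pos N}}))) ⟩
    s * (fromℕ N * fromℕ N ⁻¹)          ≡⟨ solve 4 (λ m t n r → (m :* t) :* (n :* r) := ((n :* m) :* t) :* r) refl (fromℕ M) (step x (N ℕ.* M)) (fromℕ N) (fromℕ N ⁻¹) ⟩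
    fromℕ N * fromℕ M * step x (N ℕ.* M) * fromℕ N ⁻¹
                                        ≡⟨ cong (λ t → t * step x (N ℕ.* M) * fromℕ N ⁻¹) (fromℕ-* N M) ⟨
    fromℕ (N ℕ.* M) * step x (N ℕ.* M) * fromℕ N ⁻¹
                                        ≡⟨ cong (_* fromℕ N ⁻¹) (fromℕ*step (N ℕ.* M) {{ℕ.m*n≢0 N M}}) ⟩
    step x N                            ∎
    where
    open ≡-Reasoning
    s = fromℕ M * step x (N ℕ.* M)

  module _ (N M : ℕ) .{{_ : ℕ.NonZero N}} .{{_ : ℕ.NonZero M}} where
    private
      h c : ℚ
      h = step x N
      c = step x (N ℕ.* M)

      Mc≡h : fromℕ M * c ≡ h
      Mc≡h = step-refine N M

      node-refine : ∀ j i → node x (N ℕ.* M) (j ℕ.* M ℕ.+ i) ≡ node x N j + fromℕ i * c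
      node-refine j i = trans (cong (λ t → 1ℚ + t * c)
          (trans (fromℕ-+ (j ℕ.* M) i) (cong (_+ fromℕ i) (fromℕ-* j M))))
        (trans (solve 4 (λ j m i c → con 1ℚ :+ (j :* m :+ i) :* c
                                  := (con 1ℚ :+ j :* (m :* c)) :+ i :* c) refl
                 (fromℕ j) (fromℕ M) (fromℕ i) c)
               (cong (λ t → 1ℚ + fromℕ j * t + fromℕ i * c) Mc≡h))

      node-suc : ∀ j → node x N j + fromℕ M * c ≡ node x N (suc j)
      node-suc j = trans (cong (node x N j +_) Mc≡h)
        (trans (solve 2 (λ a h → (con 1ℚ :+ a :* h) :+ h := con 1ℚ :+ (con 1ℚ :+ a) :* h) refl (fromℕ j) h)
               (cong (λ t → 1ℚ + t * h) (sym (fromℕ-+ 1 j))))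

      blocks : ℕ → ℚ
      blocks j = ∑ M λ i → c * (node x N j + fromℕ (suc i) * c) ⁻¹

      riemann-blocks : riemann x (N ℕ.* M) ≡ ∑ N blocks
      riemann-blocks = trans (∑-blocks N M _) (∑-cong N λ j → ∑-cong M λ i →
        cong (λ t → c * t ⁻¹) (trans (cong (node x (N ℕ.* M)) (sym (ℕ.+-suc (j ℕ.* M) i)))
                                    (node-refine j (suc i))))

      module B (j : ℕ) (j<N : j ℕ.< N) = Block (node x N j) c M
        (node-pos N j (ℕ.<⇒≤ j<N))
        (subst Positive (sym (node-suc j)) (node-pos N (suc j) j<N))

      telescope : ∀ k → ∑ k (λ j → h * node x N j ⁻¹)
                      ≡ ∑ k (λ j → h * node x N (suc j) ⁻¹) + h * (node x N 0 ⁻¹ - node x N k ⁻¹)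
      telescope zero    = solve 2 (λ h a → con 0ℚ := con 0ℚ :+ h :* (a :- a)) refl h (node x N 0 ⁻¹)
      telescope (suc k) = trans (cong (_+ h * node x N k ⁻¹) (telescope k))
        (solve 5 (λ s h a b c → (s :+ h :* (a :- b)) :+ h :* b
                             := (s :+ h :* c) :+ h :* (a :- c)) refl
           (∑ k λ j → h * node x N (suc j) ⁻¹) h
           (node x N 0 ⁻¹) (node x N k ⁻¹) (node x N (suc k) ⁻¹))

    riemann-refine-≥ : riemann x N ≤ riemann x (N ℕ.* M)
    riemann-refine-≥ = subst (riemann x N ≤_) (sym riemann-blocks)
      (∑-mono N λ j j<N → subst (_≤ blocks j)
        (cong₂ (λ s t → s * t ⁻¹) Mc≡h (node-suc j)) (B.lower j j<N))

    riemann-refine-≤ : riemann x (N ℕ.* M) ≤ riemann x N + spread * fromℕ N ⁻¹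
    riemann-refine-≤ = begin
      riemann x (N ℕ.* M)
        ≡⟨ riemann-blocks ⟩
      ∑ N blocks
        ≤⟨ (∑-mono N λ j j<N → subst (blocks j ≤_)
             (cong (_* node x N j ⁻¹) Mc≡h) (B.upper j j<N)) ⟩
      ∑ N (λ j → h * node x N j ⁻¹)
        ≡⟨ telescope N ⟩
      riemann x N + h * (node x N 0 ⁻¹ - node x N N ⁻¹)
        ≡⟨ cong (riemann x N +_) (cong₂ (λ s t → h * (s ⁻¹ - t ⁻¹)) node-first (node-last N)) ⟩
      riemann x N + h * (1ℚ - x ⁻¹)
        ≡⟨ cong (riemann x N +_) (solve 3 (λ a b c → a :* b :* c := a :* c :* b) refl (x - 1ℚ) (fromℕ N ⁻¹) (1ℚ - x ⁻¹)) ⟩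
      riemann x N + spread * fromℕ N ⁻¹ ∎
      where
      open ≤-Reasoning
      node-first : node x N 0 ≡ 1ℚ
      node-first = solve 1 (λ h → con 1ℚ :+ con 0ℚ :* h := con 1ℚ) refl h

  riemann-≤ : ∀ M N .{{_ : ℕ.NonZero M}} .{{_ : ℕ.NonZero N}} →
              riemann x M ≤ riemann x N + spread * fromℕ N ⁻¹
  riemann-≤ M N = ≤-trans (riemann-refine-≥ M N)
    (subst (λ k → riemann x k ≤ riemann x N + spread * fromℕ N ⁻¹) (ℕ.*-comm N M) (riemann-refine-≤ N M))

  spread-≤ : ∀ ε → Positive ε → ∃[ N ] ∀ n → N ℕ.≤ n → spread * fromℕ (suc n) ⁻¹ ≤ ε
  spread-≤ ε ε>0 = let N , le = archimedean (spread * ε ⁻¹) in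
    N , λ n N≤n → let r = fromℕ (suc n) in *-cancelʳ-≤-pos (r * ε ⁻¹)
      {{pos*pos⇒pos r {{fromℕ-pos (suc n)}} (ε ⁻¹) {{⁻¹-pos ε {{ε>0}}}}}} (begin
        spread * r ⁻¹ * (r * ε ⁻¹)  ≡⟨ solve 4 (λ s r r' e → s :* r' :* (r :* e) := s :* e :* (r :* r')) refl spread r (r ⁻¹) (ε ⁻¹) ⟩
        spread * ε ⁻¹ * (r * r ⁻¹)  ≡⟨ trans (cong (spread * ε ⁻¹ *_) (⁻¹-inverseʳ r {{fromℕ-pos (suc n)}})) (*-identityʳ _) ⟩
        spread * ε ⁻¹               ≤⟨ le ⟩
        fromℕ N                     ≤⟨ fromℕ-mono (ℕ.m≤n⇒m≤1+n N≤n) ⟩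
        r                           ≡⟨ trans (cong (r *_) (⁻¹-inverseʳ ε {{ε>0}})) (*-identityʳ _) ⟨
        r * (ε * ε ⁻¹)              ≡⟨ solve 3 (λ r e e' → r :* (e :* e') := e :* (r :* e')) refl r ε (ε ⁻¹) ⟩
        ε * (r * ε ⁻¹)              ∎)
    where open ≤-Reasoning

  riemann-cauchy : Cauchy (λ i → riemann x (suc i))
  riemann-cauchy ε ε>0 = let N , small = spread-≤ ε ε>0 in
    N , λ m n N≤m N≤n → ∣p∣≤
      (≤-trans (≤+⇒-≤ (riemann x (suc m)) (riemann x (suc n)) _ (riemann-≤ (suc m) (suc n))) (small n N≤n))
      (subst (_≤ ε) (solve 2 (λ a b → b :- a := :- (a :- b)) refl (riemann x (suc m)) (riemann x (suc n)))
        (≤-trans (≤+⇒-≤ (riemann x (suc n)) (riemann x (suc m)) _ (riemann-≤ (suc n) (suc m))) (small m N≤m)))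

ln : (x : ℚ) → .{{Positive x}} → ℝ
ln x = mkℝ (λ i → riemann x (suc i)) (riemann-cauchy x)

{-# OPTIONS --safe #-}

-- The members of F of a fixed size s form an antichain, so every point lies in
-- at most k of them; counting incidences gives s |F_s| ≤ k n.  Hence |F| is at
-- most 1 + n + k n (1/2 + ⋯ + 1/n), where 1 and n bound |F₀| and |F₁|.  The
-- harmonic sum is the lower Riemann sum of ∫₁ⁿ dt/t with n − 1 unit steps, so
-- it is at most ln n.
module Submission where

open import Defs
open import Data.Nat.Base using (ℕ; NonZero)

open import Data.Nat.Base as ℕ using (zero; suc; z≤n; s≤s)
open import Data.Nat.ListAction using (sum)
import Data.Nat.Properties as ℕ
open import Data.Rational.Base as ℚ using (ℚ; 0ℚ; 1ℚ; _+_; _-_; _*_; _≤_; Positive)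
open import Data.Rational.Properties
open import Data.Rational.Solver using (module +-*-Solver)
open import Data.Bool.Base using (true; false)
open import Data.Fin.Base using (Fin; zero; suc)
open import Data.Fin.Subset using (Subset; _⊆_; ⁅_⁆; inside; outside)
  renaming (_∈_ to _∈ₛ_; ∣_∣ to card; ⊥ to ∅)
open import Data.Fin.Subset.Properties
  using (_∈?_; ∣p∣≤n; ∣⊥∣≡0; ∣⁅x⁆∣≡1; x∈⁅y⁆⇒x≡y; ⊥⊆; p⊆q⇒∣p∣≤∣q∣; drop-∷-⊆)
open import Data.List.Base using (List; []; _∷_; length; map; filter)
open import Data.List.Properties using (filter-all)
open import Data.List.Membership.Propositional using (_∈_)
open import Data.List.Membership.Propositional.Properties using (∈-filter⁻)
open import Data.List.Relation.Unary.All as All using (All; []; _∷_)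
open import Data.List.Relation.Unary.All.Properties using (all-filter)
open import Data.List.Relation.Unary.Any using (here; there)
open import Data.List.Relation.Unary.AllPairs using (_∷_)
open import Data.List.Relation.Unary.Unique.Propositional using (Unique)
open import Data.List.Relation.Unary.Unique.Propositional.Properties using (filter⁺)
open import Data.Product.Base using (_×_; _,_; proj₂)
open import Data.Sum.Base using (_⊎_; inj₁; inj₂; [_,_])
open import Data.Vec.Base using ([]; _∷_; tail)
import Data.Vec.Base as Vec
open import Algebra.Properties.CommutativeSemigroup ℕ.+-commutativeSemigroup using (x∙yz≈y∙xz)
open import Function.Base using (_∘_)
open import Level using (0ℓ)
open import Relation.Nullary using (¬_; yes; no; does; contradiction)
open import Relation.Unary using (Pred; Decidable)
open import Relation.Binary.PropositionalEquality
  using (_≡_; refl; sym; trans; cong; cong₂; subst; subst₂)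
open +-*-Solver using (solve; _:=_; _:+_; _:*_; _:-_; con)

-- Inclusion and cardinality of finite sets

⊆∧card≡⇒≡ : ∀ {n} {U V : Subset n} → U ⊆ V → card U ≡ card V → U ≡ V
⊆∧card≡⇒≡ {U = []}          {[]}          _   _  = refl
⊆∧card≡⇒≡ {U = inside  ∷ _} {inside  ∷ _} U⊆V eq =
  cong (inside ∷_) (⊆∧card≡⇒≡ (drop-∷-⊆ U⊆V) (ℕ.suc-injective eq))
⊆∧card≡⇒≡ {U = outside ∷ _} {outside ∷ _} U⊆V eq =
  cong (outside ∷_) (⊆∧card≡⇒≡ (drop-∷-⊆ U⊆V) eq)
-- Here the tail of `U` would have one element more than the tail of `V`, which contains it.
⊆∧card≡⇒≡ {U = outside ∷ _} {inside  ∷ _} U⊆V eq =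
  contradiction (subst (ℕ._≤ _) eq (p⊆q⇒∣p∣≤∣q∣ (drop-∷-⊆ U⊆V))) ℕ.1+n≰n
⊆∧card≡⇒≡ {U = inside  ∷ _} {outside ∷ _} U⊆V eq with () ← U⊆V Vec.here

card≡0⇒≡∅ : ∀ {n} {U : Subset n} → card U ≡ 0 → U ≡ ∅
card≡0⇒≡∅ {n} eq = sym (⊆∧card≡⇒≡ ⊥⊆ (trans (∣⊥∣≡0 n) (sym eq)))

card≡1∧∈⇒≡⁅⁆ : ∀ {n} {x : Fin n} {U} → card U ≡ 1 → x ∈ₛ U → U ≡ ⁅ x ⁆
card≡1∧∈⇒≡⁅⁆ {x = x} {U} eq x∈U = sym (⊆∧card≡⇒≡
  (λ y∈⁅x⁆ → subst (_∈ₛ U) (sym (x∈⁅y⁆⇒x≡y x y∈⁅x⁆)) x∈U)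
  (trans (∣⁅x⁆∣≡1 x) (sym eq)))

unique-constant⇒length≤1 : ∀ {A : Set} {c : A} {xs} → Unique xs →
                           (∀ {x} → x ∈ xs → x ≡ c) → length xs ℕ.≤ 1
unique-constant⇒length≤1 {xs = []}         _                  _     = z≤n
unique-constant⇒length≤1 {xs = _ ∷ []}     _                  _     = s≤s z≤n
unique-constant⇒length≤1 {xs = _ ∷ _ ∷ _} ((x≢y ∷ _) ∷ _) const =
  contradiction (trans (const (here refl)) (sym (const (there (here refl))))) x≢y

-- Counting incidences between points and sets

star : ∀ {n} → Fin n → List (Subset n) → List (Subset n)
star x = filter (x ∈?_)

layer : ∀ {n} → ℕ → List (Subset n) → List (Subset n)
layer s = filter (λ U → card U ℕ.≟ s)

∈-star-layer⁻ : ∀ {n} (x : Fin n) s {U} Us → U ∈ star x (layer s Us) →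
                U ∈ Us × card U ≡ s × x ∈ₛ U
∈-star-layer⁻ x s Us U∈ =
  let U∈layer , x∈U = ∈-filter⁻ (x ∈?_) {xs = layer s Us} U∈
      U∈Us , eq     = ∈-filter⁻ (λ U → card U ℕ.≟ s) U∈layer
  in U∈Us , eq , x∈U

length-star-suc : ∀ {n} (x : Fin n) Us →
                  length (star (suc x) Us) ≡ length (star x (map tail Us))
length-star-suc x []             = refl
length-star-suc x ((_ ∷ U) ∷ Us) with does (x ∈? U)
... | true  = cong suc (length-star-suc x Us)
... | false = length-star-suc x Us

-- The left side counts all incidences; those with the point `zero` are split off, and the others
-- survive in the tails.
sum-card-suc : ∀ {n} (Us : List (Subset (suc n))) →
  sum (map card Us) ≡ length (star zero Us) ℕ.+ sum (map card (map tail Us))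
sum-card-suc []                   = refl
sum-card-suc ((inside  ∷ U) ∷ Us) = cong suc (trans (cong (card U ℕ.+_) (sum-card-suc Us))
  (x∙yz≈y∙xz (card U) (length (star zero Us)) _))
sum-card-suc ((outside ∷ U) ∷ Us) = trans (cong (card U ℕ.+_) (sum-card-suc Us))
  (x∙yz≈y∙xz (card U) (length (star zero Us)) _)

-- Double counting by induction on the ground set, one point at a time. Lists take the place of
-- families because distinct sets may have equal tails, and these must be counted with multiplicity.
sum-card-≤ : ∀ {n} c (Us : List (Subset n)) → (∀ x → length (star x Us) ℕ.≤ c) →
             sum (map card Us) ℕ.≤ n ℕ.* c
sum-card-≤ {zero}  c []        _ = z≤n
sum-card-≤ {zero}  c ([] ∷ Us) _ = sum-card-≤ c Us λ ()
sum-card-≤ {suc n} c Us        h = subst (ℕ._≤ c ℕ.+ n ℕ.* c) (sym (sum-card-suc Us))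
  (ℕ.+-mono-≤ (h zero) (sum-card-≤ c (map tail Us) λ x →
    subst (ℕ._≤ c) (length-star-suc x Us) (h (suc x))))

sum-map-constant : ∀ {A : Set} {f : A → ℕ} {s xs} → All (λ x → f x ≡ s) xs →
                   sum (map f xs) ≡ length xs ℕ.* s
sum-map-constant []         = refl
sum-map-constant (eq ∷ eqs) = cong₂ ℕ._+_ eq (sum-map-constant eqs)

-- Each set of the layer contributes exactly `s` incidences, and each of the `n` points at most `c`.
length-layer-*-≤ : ∀ {n} c s (Us : List (Subset n)) →
                   (∀ x → length (star x (layer s Us)) ℕ.≤ c) →
                   length (layer s Us) ℕ.* s ℕ.≤ n ℕ.* c
length-layer-*-≤ c s Us h = subst (ℕ._≤ _)
  (sum-map-constant (all-filter (λ U → card U ℕ.≟ s) Us))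
  (sum-card-≤ c (layer s Us) h)

-- Bounds on the layers of a family

module _ {n : ℕ} (F : Family n) where

  private
    unique-layer : ∀ s → Unique (layer s (members F))
    unique-layer s = filter⁺ (λ U → card U ℕ.≟ s) (unique F)

    unique-star-layer : ∀ x s → Unique (star x (layer s (members F)))
    unique-star-layer x s = filter⁺ (x ∈?_) (unique-layer s)

  length-layer₀ : length (layer 0 (members F)) ℕ.≤ 1
  length-layer₀ = unique-constant⇒length≤1 (unique-layer 0) λ U∈ →
    card≡0⇒≡∅ (proj₂ (∈-filter⁻ (λ U → card U ℕ.≟ 0) {xs = members F} U∈))

  length-layer₁ : length (layer 1 (members F)) ℕ.≤ n
  length-layer₁ = subst₂ ℕ._≤_ (ℕ.*-identityʳ _) (ℕ.*-identityʳ n)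
    -- The incidence count with one set per point: the only one-element set through `x` is its
    -- singleton. This makes the bound independent of `k`.
    (length-layer-*-≤ 1 1 (members F) λ x →
      unique-constant⇒length≤1 (unique-star-layer x 1) λ U∈ →
        let _ , eq , x∈U = ∈-star-layer⁻ x 1 (members F) U∈ in card≡1∧∈⇒≡⁅⁆ eq x∈U)

  -- The sets of size `s` through a point form an antichain, as an inclusion between sets of equal
  -- size is an equality. Local width therefore bounds the incidences at each point by `k`.
  locallyWide⇒length-layer : ∀ {k} → LocallyWide k F → ∀ s →
    length (layer s (members F)) ℕ.* s ℕ.≤ n ℕ.* k
  locallyWide⇒length-layer {k} wide s = length-layer-*-≤ k s (members F) λ x →
    let A   = family (star x (layer s (members F))) (unique-star-layer x s)
        inv = λ {U} → ∈-star-layer⁻ x s {U} (members F)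
    in wide x A
      (λ _ U∈ → let U∈F , _ , x∈U = inv U∈ in U∈F , x∈U)
      (λ _ _ U∈ V∈ U⊆V → let _ , eqU , _ = inv U∈; _ , eqV , _ = inv V∈ in
        ⊆∧card≡⇒≡ U⊆V (trans eqU (sym eqV)))

-- Decomposition of a family by cardinality

module _ {A : Set} {P Q R : Pred A 0ℓ}
         (P? : Decidable P) (Q? : Decidable Q) (R? : Decidable R) where

  length-filter-⊎ : (∀ {x} → P x → ¬ Q x) → (∀ {x} → P x ⊎ Q x → R x) →
    (∀ {x} → R x → P x ⊎ Q x) → ∀ xs →
    length (filter R? xs) ≡ length (filter P? xs) ℕ.+ length (filter Q? xs)
  length-filter-⊎ P⇒¬Q P⊎Q⇒R R⇒P⊎Q = go
    where
    go : ∀ xs → length (filter R? xs) ≡ length (filter P? xs) ℕ.+ length (filter Q? xs)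
    go []       = refl
    go (x ∷ xs) with R? x | P? x | Q? x
    ... | yes _  | yes _  | no _   = cong suc (go xs)
    ... | yes _  | no _   | yes _  = trans (cong suc (go xs)) (sym (ℕ.+-suc _ _))
    ... | no _   | no _   | no _   = go xs
    ... | _      | yes p  | yes q  = contradiction q (P⇒¬Q p)
    ... | yes r  | no ¬p  | no ¬q  = contradiction (R⇒P⊎Q r) [ ¬p , ¬q ]
    ... | no ¬r  | yes p  | no _   = contradiction (P⊎Q⇒R (inj₁ p)) ¬r
    ... | no ¬r  | no _   | yes q  = contradiction (P⊎Q⇒R (inj₂ q)) ¬r

length-filter-<suc : ∀ {A : Set} (f : A → ℕ) m xs →
  length (filter (λ x → f x ℕ.<? suc m) xs) ≡
  length (filter (λ x → f x ℕ.<? m) xs) ℕ.+ length (filter (λ x → f x ℕ.≟ m) xs)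
length-filter-<suc f m = length-filter-⊎
  (λ x → f x ℕ.<? m) (λ x → f x ℕ.≟ m) (λ x → f x ℕ.<? suc m)
  ℕ.<⇒≢ [ ℕ.m<n⇒m<1+n , s≤s ∘ ℕ.≤-reflexive ] (ℕ.m≤n⇒m<n∨m≡n ∘ ℕ.s≤s⁻¹)

length-filter-< : ∀ {A : Set} (f : A → ℕ) m xs →
  fromℕ (length (filter (λ x → f x ℕ.<? m) xs)) ≡
  ∑ m (λ s → fromℕ (length (filter (λ x → f x ℕ.≟ s) xs)))
length-filter-< f zero    []       = refl
length-filter-< f zero    (x ∷ xs) = length-filter-< f zero xs
length-filter-< f (suc m) xs       = trans (cong fromℕ (length-filter-<suc f m xs))
  (trans (fromℕ-+ (length (filter (λ x → f x ℕ.<? m) xs)) _)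
         (cong (_+ fromℕ (length (filter (λ x → f x ℕ.≟ m) xs))) (length-filter-< f m xs)))

size≡∑layers : ∀ {n} (Us : List (Subset n)) →
  fromℕ (length Us) ≡ ∑ (suc n) (λ s → fromℕ (length (layer s Us)))
size≡∑layers {n} Us = trans
  (cong (λ Vs → fromℕ (length Vs))
    -- No subset has more than `n` elements, so the threshold `suc n` filters nothing out.
    (sym (filter-all (λ U → card U ℕ.<? suc n) (All.universal (λ U → s≤s (∣p∣≤n U)) Us))))
  (length-filter-< card (suc n) Us)

-- The bound by a harmonic sum

∑-*ˡ : ∀ m c f → ∑ m (λ i → c * f i) ≡ c * ∑ m f
∑-*ˡ zero    c f = sym (*-zeroʳ c)
∑-*ˡ (suc m) c f = trans (cong (_+ c * f m) (∑-*ˡ m c f)) (sym (*-distribˡ-+ c (∑ m f) (f m)))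

*≤⇒≤*⁻¹ : ∀ {p q} r → .{{Positive r}} → p * r ≤ q → p ≤ q * r ⁻¹
*≤⇒≤*⁻¹ {p} {q} r pr≤q = subst (_≤ q * r ⁻¹)
  (trans (*-assoc p r (r ⁻¹)) (trans (cong (p *_) (⁻¹-inverseʳ r)) (*-identityʳ p)))
  (*-monoʳ-≤-nonNeg (r ⁻¹) {{pos⇒nonNeg (r ⁻¹) {{⁻¹-pos r}}}} pr≤q)

-- With n = m + 1 this is 1/2 + ⋯ + 1/n, the harmonic number of n without its first term.
harmonic₂ : ℕ → ℚ
harmonic₂ m = ∑ m λ i → fromℕ (2 ℕ.+ i) ⁻¹

size≤harmonic : ∀ {m k} (F : Family (suc m)) → LocallyWide k F →
  fromℕ (size F) ≤ 1ℚ + fromℕ (suc m) + fromℕ k * fromℕ (suc m) * harmonic₂ m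
size≤harmonic {m} {k} F wide = begin
  fromℕ (size F)                                ≡⟨ size≡∑layers (members F) ⟩
  -- Sizes 0 and 1 are split off for their own bounds; from size 2 on, the incidence bound is
  -- divided by the size.
  ∑ (2 ℕ.+ m) f                                 ≡⟨ ∑-split 2 m f ⟩
  0ℚ + f 0 + f 1 + rest                         ≡⟨ cong (λ p → p + f 1 + rest) (+-identityˡ (f 0)) ⟩
  f 0 + f 1 + rest
    ≤⟨ +-mono-≤ (+-mono-≤ (fromℕ-mono (length-layer₀ F)) (fromℕ-mono (length-layer₁ F)))
                (∑-mono m λ i _ → *≤⇒≤*⁻¹ (fromℕ (2 ℕ.+ i)) {{fromℕ-pos (2 ℕ.+ i)}} (layer≤ (2 ℕ.+ i))) ⟩
  1ℚ + n + ∑ m (λ i → fromℕ k * n * fromℕ (2 ℕ.+ i) ⁻¹)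
    ≡⟨ cong (1ℚ + n +_) (∑-*ˡ m (fromℕ k * n) _) ⟩
  1ℚ + n + fromℕ k * n * harmonic₂ m            ∎
  where
  open ≤-Reasoning
  n = fromℕ (suc m)
  f : ℕ → ℚ
  f s = fromℕ (length (layer s (members F)))
  rest = ∑ m λ i → f (2 ℕ.+ i)
  layer≤ : ∀ s → f s * fromℕ s ≤ fromℕ k * n
  layer≤ s = subst₂ _≤_ (fromℕ-* (length (layer s (members F))) s)
    (trans (cong fromℕ (ℕ.*-comm (suc m) k)) (fromℕ-* k (suc m)))
    (fromℕ-mono (locallyWide⇒length-layer F wide s))

-- Comparison with the logarithm

-- Cutting the interval from 1 to m + 1 into m pieces gives unit steps with right endpoints 2, ...,
-- m + 1.
harmonic≡riemann : ∀ m → .{{_ : NonZero m}} → harmonic₂ m ≡ riemann (fromℕ (suc m)) m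
harmonic≡riemann m = ∑-cong m λ j → sym (trans
  (cong₂ _*_ step≡1 (cong _⁻¹ (node≡ j))) (*-identityˡ _))
  where
  step≡1 : step (fromℕ (suc m)) m ≡ 1ℚ
  step≡1 = trans (cong (λ p → (p - 1ℚ) * fromℕ m ⁻¹) (fromℕ-+ 1 m))
    (trans (cong (_* fromℕ m ⁻¹) (solve 1 (λ p → con 1ℚ :+ p :- con 1ℚ := p) refl (fromℕ m)))
           (⁻¹-inverseʳ (fromℕ m) {{fromℕ-pos m}}))
  node≡ : ∀ j → node (fromℕ (suc m)) m (suc j) ≡ fromℕ (2 ℕ.+ j)
  node≡ j = trans (cong (λ p → 1ℚ + fromℕ (suc j) * p) step≡1)
    (trans (cong (1ℚ +_) (*-identityʳ (fromℕ (suc j)))) (sym (fromℕ-+ 1 (suc j))))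

-- A common refinement shows that the sum with `m` steps exceeds the one with `suc i` steps by at
-- most `spread` divided by `suc i`, which is eventually below `ε`.
harmonic≤ln : ∀ m → fromℚ (harmonic₂ m) ≤ᴿ ln (fromℕ (suc m)) {{fromℕ-pos (suc m)}}
harmonic≤ln m ε ε>0 =
  let N , small = spread-≤ x {{x>0}} ε ε>0 in
  N , λ i N≤i → ≤-trans (bound m i) (+-monoʳ-≤ (riemann x (suc i)) (small i N≤i))
  where
  x   = fromℕ (suc m)
  x>0 = fromℕ-pos (suc m)
  bound : ∀ m i → let x = fromℕ (suc m) in
    harmonic₂ m ≤ riemann x (suc i) + spread x {{fromℕ-pos (suc m)}} * fromℕ (suc i) ⁻¹
  -- The interval is the single point 1. A partition needs at least one step, so one step of length
  -- 0 stands for the empty sum.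
  bound zero    i = riemann-≤ 1ℚ 1 (suc i)
  bound (suc m) i = ≤-trans (≤-reflexive (harmonic≡riemann (suc m)))
    (riemann-≤ (fromℕ (2 ℕ.+ m)) {{fromℕ-pos (2 ℕ.+ m)}} (suc m) (suc i))

-- Passage to the real inequality

theorem3p3p6 : (n k : ℕ) → .{{_ : NonZero n}} → (F : Family n) → LocallyWide k F →
    fromℕᴿ (size F) ≤ᴿ fromℕᴿ 2 +ᴿ fromℕᴿ n +ᴿ fromℕᴿ k *ᴿ fromℕᴿ n *ᴿ ln (fromℕ n) {{fromℕ-pos n}}
theorem3p3p6 (suc m) k F wide ε ε>0 =
  let N , harmonic≤ = harmonic≤ln m δ δ>0 in
  N , λ i N≤i → begin
    fromℕ (size F)                      ≤⟨ size≤harmonic F wide ⟩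
    1ℚ + n + c * harmonic₂ m
      -- The constant 1 of the harmonic bound is relaxed to 2.
      ≤⟨ +-mono-≤ (+-monoˡ-≤ n (fromℕ-mono {1} {2} (s≤s z≤n)))
                  (*-monoˡ-≤-nonNeg c {{ℚ.nonNegative 0≤c}} (harmonic≤ i N≤i)) ⟩
    fromℕ 2 + n + c * (ρ i + δ)         ≡⟨ cong (fromℕ 2 + n +_) (*-distribˡ-+ c (ρ i) δ) ⟩
    fromℕ 2 + n + (c * ρ i + c * δ)     ≡⟨ +-assoc (fromℕ 2 + n) (c * ρ i) (c * δ) ⟨
    fromℕ 2 + n + c * ρ i + c * δ       ≤⟨ +-monoʳ-≤ (fromℕ 2 + n + c * ρ i) cδ≤ε ⟩
    fromℕ 2 + n + c * ρ i + ε           ∎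
  where
  open ≤-Reasoning
  n = fromℕ (suc m)
  c = fromℕ k * n
  0≤c : 0ℚ ≤ c
  0≤c = 0≤* (fromℕ-nonNeg k) (fromℕ-nonNeg (suc m))
  ρ : ℕ → ℚ
  ρ i = riemann n (suc i)
  -- 1 + c rather than c, which vanishes for k = 0
  b = 1ℚ + c
  b>0 : Positive b
  b>0 = pos+nonNeg⇒pos 1ℚ c {{ℚ.nonNegative 0≤c}}
  -- The error of the logarithm comparison gets multiplied by `c`, and c δ ≤ (1 + c) δ = ε.
  δ = ε * b ⁻¹
  δ>0 : Positive δ
  δ>0 = pos*pos⇒pos ε {{ε>0}} (b ⁻¹) {{⁻¹-pos b {{b>0}}}}
  cδ≤ε : c * δ ≤ ε
  cδ≤ε = begin
    c * δ                ≤⟨ p≤p+q (<⇒≤ (positive⁻¹ δ {{δ>0}})) ⟩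
    c * δ + δ            ≡⟨ solve 3 (λ c ε r → c :* (ε :* r) :+ ε :* r := ε :* ((con 1ℚ :+ c) :* r)) refl c ε (b ⁻¹) ⟩
    ε * (b * b ⁻¹)       ≡⟨ trans (cong (ε *_) (⁻¹-inverseʳ b {{b>0}})) (*-identityʳ ε) ⟩
    ε                    ∎
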